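{- Let $(\Omega,\star,\star,\triangleleft,\triangleright)$ be an extended diassociative semigroup (EDS) (i.e. one with $\leftarrow=\rightarrow=\star$) such that $(\Omega,\star)$ is a group. There exist three subgroups $K$, $H_\triangleleft$ and $H_\triangleright$ of $\Omega$ such that $$\Omega=K\rtimes H_\triangleleft=K\rtimes H_\triangleright.$$ Moreover, for any $\alpha,\beta\in\Omega$, $\alpha\triangleleft\beta$ is the canonical projection of $\beta$ on $H_\triangleleft$ and $\alpha\triangleright\beta$ is the canonical projection of $\alpha$ on $H_\triangleright$.
   Context: Extended diassociative semigroups. A diassociative semigroup is a set $\Omega$ with maps $\leftarrow,\rightarrow:\Omega\times\Omega\to\Omega$ such that for all $\alpha,\beta,\gamma\in\Omega$: $(\alpha\leftarrow\beta)\leftarrow\gamma=\alpha\leftarrow(\beta\leftarrow\gamma)=\alpha\leftarrow(\beta\rightarrow\gamma)$; $(\alpha\rightarrow\beta)\leftarrow\gamma=\alpha\rightarrow(\beta\leftarrow\gamma)$; $(\alpha\rightarrow\beta)\rightarrow\gamma=(\alpha\leftarrow\beta)\rightarrow\gamma=\alpha\rightarrow(\beta\rightarrow\gamma)$. An extended diassociative semigroup (EDS) is $(\Omega,\leftarrow,\rightarrow,\triangleleft,\triangleright)$ such that $(\Omega,\leftarrow,\rightarrow)$ is a diassociative semigroup and for all $\alpha,\beta,\gamma\in\Omega$: $\alpha\triangleright(\beta\leftarrow\gamma)=\alpha\triangleright\beta$; $(\alpha\rightarrow\beta)\triangleleft\gamma=\beta\triangleleft\gamma$; $(\alpha\triangleleft\beta)\leftarrow((\alpha\leftarrow\beta)\triangleleft\gamma)=\alpha\triangleleft(\beta\leftarrow\gamma)$;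 $(\alpha\triangleleft\beta)\triangleleft((\alpha\leftarrow\beta)\triangleleft\gamma)=\beta\triangleleft\gamma$; $(\alpha\triangleleft\beta)\rightarrow((\alpha\leftarrow\beta)\triangleleft\gamma)=\alpha\triangleleft(\beta\rightarrow\gamma)$; $(\alpha\triangleleft\beta)\triangleright((\alpha\leftarrow\beta)\triangleleft\gamma)=\beta\triangleright\gamma$; $(\alpha\triangleright(\beta\rightarrow\gamma))\leftarrow(\beta\triangleright\gamma)=(\alpha\leftarrow\beta)\triangleright\gamma$; $(\alpha\triangleright(\beta\rightarrow\gamma))\triangleleft(\beta\triangleright\gamma)=\alpha\triangleleft\beta$; $(\alpha\triangleright(\beta\rightarrow\gamma))\rightarrow(\beta\triangleright\gamma)=(\alpha\rightarrow\beta)\triangleright\gamma$; $(\alpha\triangleright(\beta\rightarrow\gamma))\triangleright(\beta\triangleright\gamma)=\alpha\triangleright\beta$. $\Omega=K\rtimes H$ means the internal semidirect product: $K$ is a normal subgroup, $H$ a subgroup, $K\cap H=\{e\}$ and $K\star H=\Omega$. The canonical projection on $H$ is $k\star h\mapsto h$ for $k\in K$, $h\in H$. -}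

module Defs where

open import Algebra.Bundles using (Group)
open import Algebra.Core using (Op₂)
import Algebra.Definitions
import Algebra.Properties.Group
open import Data.Product.Base using (∃₂; _×_; _,_; proj₁; proj₂)
open import Level using (Level; _⊔_; suc)
open import Relation.Binary.Core using (Rel)
open import Relation.Binary.Definitions using (_Respects_)
open import Relation.Binary.Structures using (IsEquivalence)
import Relation.Binary.Reasoning.Setoid
open import Relation.Unary using (Pred; _∈_; _∩_; _≐_)

module _ {c ℓ} {Ω : Set c} (_≈_ : Rel Ω ℓ) where

  open Algebra.Definitions _≈_ using (Congruent₂)

  record IsDiassociativeSemigroup (_←_ _⇾_ : Op₂ Ω) : Set (c ⊔ ℓ) where
    field
      isEquivalence : IsEquivalence _≈_
      ←-cong        : Congruent₂ _←_
      ⇾-cong        : Congruent₂ _⇾_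
      ←-assoc       : ∀ α β γ → ((α ← β) ← γ) ≈ (α ← (β ← γ))
      ←-inner       : ∀ α β γ → (α ← (β ← γ)) ≈ (α ← (β ⇾ γ))
      ⇾-←-assoc     : ∀ α β γ → ((α ⇾ β) ← γ) ≈ (α ⇾ (β ← γ))
      ⇾-inner       : ∀ α β γ → ((α ⇾ β) ⇾ γ) ≈ ((α ← β) ⇾ γ)
      ⇾-assoc       : ∀ α β γ → ((α ← β) ⇾ γ) ≈ (α ⇾ (β ⇾ γ))

  record IsExtendedDiassociativeSemigroup (_←_ _⇾_ _◁_ _▷_ : Op₂ Ω) : Set (c ⊔ ℓ) where
    field
      isDiassociativeSemigroup : IsDiassociativeSemigroup _←_ _⇾_
      ◁-cong : Congruent₂ _◁_
      ▷-cong : Congruent₂ _▷_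
      ▷-←    : ∀ α β γ → (α ▷ (β ← γ)) ≈ (α ▷ β)
      ⇾-◁    : ∀ α β γ → ((α ⇾ β) ◁ γ) ≈ (β ◁ γ)
      ◁-←-◁  : ∀ α β γ → ((α ◁ β) ← ((α ← β) ◁ γ)) ≈ (α ◁ (β ← γ))
      ◁-◁-◁  : ∀ α β γ → ((α ◁ β) ◁ ((α ← β) ◁ γ)) ≈ (β ◁ γ)
      ◁-⇾-◁  : ∀ α β γ → ((α ◁ β) ⇾ ((α ← β) ◁ γ)) ≈ (α ◁ (β ⇾ γ))
      ◁-▷-◁  : ∀ α β γ → ((α ◁ β) ▷ ((α ← β) ◁ γ)) ≈ (β ▷ γ)
      ▷-←-▷  : ∀ α β γ → ((α ▷ (β ⇾ γ)) ← (β ▷ γ)) ≈ ((α ← β) ▷ γ)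
      ▷-◁-▷  : ∀ α β γ → ((α ▷ (β ⇾ γ)) ◁ (β ▷ γ)) ≈ (α ◁ β)
      ▷-⇾-▷  : ∀ α β γ → ((α ▷ (β ⇾ γ)) ⇾ (β ▷ γ)) ≈ ((α ⇾ β) ▷ γ)
      ▷-▷-▷  : ∀ α β γ → ((α ▷ (β ⇾ γ)) ▷ (β ▷ γ)) ≈ (α ▷ β)

module _ {c ℓ} (G : Group c ℓ) where

  open Group G renaming (_∙_ to _⋆_)

  record Subgroup (p : Level) : Set (c ⊔ ℓ ⊔ suc p) where
    field
      subset    : Pred Carrier p
      resp-≈    : subset Respects _≈_
      ε-closed  : ε ∈ subset
      ⋆-closed  : ∀ {x y} → x ∈ subset → y ∈ subset → (x ⋆ y) ∈ subset
      ⁻¹-closed : ∀ {x} → x ∈ subset → (x ⁻¹) ∈ subset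

  open Subgroup

  Normal : ∀ {p} → Subgroup p → Set (c ⊔ p)
  Normal K = ∀ g {k} → k ∈ subset K → ((g ⋆ k) ⋆ g ⁻¹) ∈ subset K

  record IsInternalSemidirectProduct {p q} (K : Subgroup p) (H : Subgroup q)
         : Set (c ⊔ ℓ ⊔ p ⊔ q) where
    field
      normal       : Normal K
      intersection : (subset K ∩ subset H) ≐ (_≈ ε)
      product      : ∀ x → ∃₂ λ k h → k ∈ subset K × h ∈ subset H × x ≈ (k ⋆ h)

  module _ {p q} {K : Subgroup p} {H : Subgroup q}
           (sd : IsInternalSemidirectProduct K H) where

    open IsInternalSemidirectProduct sd

    canonicalProjection : Carrier → Carrier
    canonicalProjection x = proj₁ (proj₂ (product x))

    -- The projection depends only on the subgroups, not on the
    -- decompositions chosen by `product`.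
    canonicalProjection-⋆ : ∀ {k h} → k ∈ subset K → h ∈ subset H →
                            canonicalProjection (k ⋆ h) ≈ h
    canonicalProjection-⋆ {k} {h} k∈K h∈H with product (k ⋆ h)
    ... | k′ , h′ , k′∈K , h′∈H , kh≈k′h′ =
      x∙y⁻¹≈ε⇒x≈y h′ h (proj₁ intersection (h′h⁻¹∈K , h′h⁻¹∈H))
      where
      open Algebra.Properties.Group G using (x∙y⁻¹≈ε⇒x≈y; \\-leftDividesʳ; //-rightDividesʳ)
      open Relation.Binary.Reasoning.Setoid setoid

      k′⁻¹k≈h′h⁻¹ : (k′ ⁻¹ ⋆ k) ≈ (h′ ⋆ h ⁻¹)
      k′⁻¹k≈h′h⁻¹ = begin
        k′ ⁻¹ ⋆ k                   ≈⟨ ∙-congˡ (//-rightDividesʳ h k) ⟨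
        k′ ⁻¹ ⋆ ((k ⋆ h) ⋆ h ⁻¹)    ≈⟨ ∙-congˡ (∙-congʳ kh≈k′h′) ⟩
        k′ ⁻¹ ⋆ ((k′ ⋆ h′) ⋆ h ⁻¹)  ≈⟨ ∙-congˡ (assoc k′ h′ (h ⁻¹)) ⟩
        k′ ⁻¹ ⋆ (k′ ⋆ (h′ ⋆ h ⁻¹))  ≈⟨ \\-leftDividesʳ k′ (h′ ⋆ h ⁻¹) ⟩
        h′ ⋆ h ⁻¹                   ∎

      h′h⁻¹∈K : (h′ ⋆ h ⁻¹) ∈ subset K
      h′h⁻¹∈K = resp-≈ K k′⁻¹k≈h′h⁻¹ (⋆-closed K (⁻¹-closed K k′∈K) k∈K)

      h′h⁻¹∈H : (h′ ⋆ h ⁻¹) ∈ subset H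
      h′h⁻¹∈H = ⋆-closed H h′∈H (⁻¹-closed H h∈H)

{-# OPTIONS --safe #-}
-- Putting ε in the axioms ▷-← and ⇾-◁ shows that α ◁ β depends only on β and α ▷ β only on α,
-- so the operations are two maps φ and ψ. The remaining axioms say that φ and ψ
-- are endomorphisms with φ ∘ φ = φ = φ ∘ ψ and ψ ∘ ψ = ψ = ψ ∘ φ. They therefore
-- have the same kernel K, and each retracts Ω onto its fixed points.
module Submission where

open import Defs
open import Algebra.Bundles using (Group)
open import Algebra.Core using (Op₁; Op₂)
open import Algebra.Morphism.Structures using (IsGroupHomomorphism)
import Algebra.Properties.Group
open import Data.Product.Base using (Σ-syntax; _×_; _,_)
import Relation.Binary.Reasoning.Setoid

module _ {c ℓ} (G : Group c ℓ) where

  open Group G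
  open Algebra.Properties.Group G
    using (ε⁻¹≈ε; identityʳ-unique; inverseˡ-unique; //-rightDividesˡ)
  open Relation.Binary.Reasoning.Setoid setoid

  Endomorphism : Op₁ Carrier → Set _
  Endomorphism = IsGroupHomomorphism rawGroup rawGroup

  -- Cancellation turns the idempotent `f ε` into `ε`; then `f (x ⁻¹)` is a left inverse of `f x`,
  -- hence its inverse.
  multiplicative⇒endomorphism : {f : Op₁ Carrier} →
    (∀ {x y} → x ≈ y → f x ≈ f y) →
    (∀ x y → f (x ∙ y) ≈ f x ∙ f y) →
    Endomorphism f
  multiplicative⇒endomorphism {f} f-cong f-homo = record
    { isMonoidHomomorphism = record
      { isMagmaHomomorphism = record
        { isRelHomomorphism = record { cong = f-cong }
        ; homo              = f-homo
        }
      ; ε-homo = ε-homo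
      }
    ; ⁻¹-homo = λ x → inverseˡ-unique (f (x ⁻¹)) (f x) (begin
        f (x ⁻¹) ∙ f x  ≈⟨ f-homo (x ⁻¹) x ⟨
        f (x ⁻¹ ∙ x)    ≈⟨ f-cong (inverseˡ x) ⟩
        f ε             ≈⟨ ε-homo ⟩
        ε               ∎)
    }
    where
    ε-homo : f ε ≈ ε
    ε-homo = identityʳ-unique (f ε) (f ε) (begin
      f ε ∙ f ε  ≈⟨ f-homo ε ε ⟨
      f (ε ∙ ε)  ≈⟨ f-cong (identityˡ ε) ⟩
      f ε        ∎)

  module _ {f : Op₁ Carrier} (f-endo : Endomorphism f) where

    open IsGroupHomomorphism f-endo

    kernel : Subgroup G ℓ
    kernel = record
      { subset    = λ x → f x ≈ ε
      ; resp-≈    = λ x≈y fx≈ε → trans (⟦⟧-cong (sym x≈y)) fx≈ε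
      ; ε-closed  = ε-homo
      ; ⋆-closed  = λ {x} {y} fx≈ε fy≈ε →
          trans (homo x y) (trans (∙-cong fx≈ε fy≈ε) (identityˡ ε))
      ; ⁻¹-closed = λ {x} fx≈ε →
          trans (⁻¹-homo x) (trans (⁻¹-cong fx≈ε) ε⁻¹≈ε)
      }

    kernel-normal : Normal G kernel
    kernel-normal g {k} fk≈ε = begin
      f ((g ∙ k) ∙ g ⁻¹)      ≈⟨ homo (g ∙ k) (g ⁻¹) ⟩
      f (g ∙ k) ∙ f (g ⁻¹)    ≈⟨ ∙-cong (homo g k) (⁻¹-homo g) ⟩
      (f g ∙ f k) ∙ f g ⁻¹    ≈⟨ ∙-congʳ (∙-congˡ fk≈ε) ⟩
      (f g ∙ ε) ∙ f g ⁻¹      ≈⟨ ∙-congʳ (identityʳ (f g)) ⟩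
      f g ∙ f g ⁻¹            ≈⟨ inverseʳ (f g) ⟩
      ε                       ∎

    fixedPoints : Subgroup G ℓ
    fixedPoints = record
      { subset    = λ x → f x ≈ x
      ; resp-≈    = λ x≈y fx≈x → trans (⟦⟧-cong (sym x≈y)) (trans fx≈x x≈y)
      ; ε-closed  = ε-homo
      ; ⋆-closed  = λ {x} {y} fx≈x fy≈y → trans (homo x y) (∙-cong fx≈x fy≈y)
      ; ⁻¹-closed = λ {x} fx≈x → trans (⁻¹-homo x) (⁻¹-cong fx≈x)
      }

  -- The two absorption laws give f and g the same kernel and force g to be idempotent.
  kernel⋊fixedPoints : {f g : Op₁ Carrier}
    (f-endo : Endomorphism f) (g-endo : Endomorphism g) →
    (∀ x → f (g x) ≈ f x) → (∀ x → g (f x) ≈ g x) →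
    IsInternalSemidirectProduct G (kernel f-endo) (fixedPoints g-endo)
  kernel⋊fixedPoints {f} {g} f-endo g-endo fg≈f gf≈g = record
    { normal       = kernel-normal f-endo
    ; intersection =
        (λ {x} (fx≈ε , gx≈x) → begin
          x        ≈⟨ gx≈x ⟨
          g x      ≈⟨ gf≈g x ⟨
          g (f x)  ≈⟨ G.⟦⟧-cong fx≈ε ⟩
          g ε      ≈⟨ G.ε-homo ⟩
          ε        ∎)
      , λ x≈ε → trans (F.⟦⟧-cong x≈ε) F.ε-homo
              , trans (G.⟦⟧-cong x≈ε) (trans G.ε-homo (sym x≈ε))
    -- Choosing `g x` as the second factor makes `canonicalProjection` compute to `g`.
    ; product      = λ x →
        x ∙ g x ⁻¹ , g x , quotient∈kernel x , g-idem x
      , sym (//-rightDividesˡ (g x) x)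
    }
    where
    module F = IsGroupHomomorphism f-endo
    module G = IsGroupHomomorphism g-endo

    -- Insert `f` between the two copies of `g`, let it absorb the inner one, then let the outer `g`
    -- absorb `f`.
    g-idem : ∀ x → g (g x) ≈ g x
    g-idem x = begin
      g (g x)      ≈⟨ gf≈g (g x) ⟨
      g (f (g x))  ≈⟨ G.⟦⟧-cong (fg≈f x) ⟩
      g (f x)      ≈⟨ gf≈g x ⟩
      g x          ∎

    quotient∈kernel : ∀ x → f (x ∙ g x ⁻¹) ≈ ε
    quotient∈kernel x = begin
      f (x ∙ g x ⁻¹)      ≈⟨ F.homo x (g x ⁻¹) ⟩
      f x ∙ f (g x ⁻¹)    ≈⟨ ∙-congˡ (F.⁻¹-homo (g x)) ⟩
      f x ∙ f (g x) ⁻¹    ≈⟨ ∙-congˡ (⁻¹-cong (fg≈f x)) ⟩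
      f x ∙ f x ⁻¹        ≈⟨ inverseʳ (f x) ⟩
      ε                   ∎

proposition3 : ∀ {c ℓ} (Ω : Group c ℓ) →
    let open Group Ω renaming (_∙_ to _⋆_) in
    (_◁_ _▷_ : Op₂ Carrier) →
    IsExtendedDiassociativeSemigroup _≈_ _⋆_ _⋆_ _◁_ _▷_ →
    Σ[ K ∈ Subgroup Ω ℓ ] Σ[ H◁ ∈ Subgroup Ω ℓ ] Σ[ H▷ ∈ Subgroup Ω ℓ ]
    Σ[ sd◁ ∈ IsInternalSemidirectProduct Ω K H◁ ]
    Σ[ sd▷ ∈ IsInternalSemidirectProduct Ω K H▷ ]
      (∀ α β → ((α ◁ β) ≈ canonicalProjection Ω sd◁ β)
             × ((α ▷ β) ≈ canonicalProjection Ω sd▷ α))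
proposition3 Ω _◁_ _▷_ eds =
    kernel Ω φ-endo , fixedPoints Ω φ-endo , fixedPoints Ω ψ-endo
  , kernel⋊fixedPoints Ω φ-endo φ-endo φφ≈φ φφ≈φ
  -- The kernel is again that of `φ`, so that both decompositions share literally the same `K`.
  , kernel⋊fixedPoints Ω φ-endo ψ-endo φψ≈φ ψφ≈ψ
  -- The two canonical projections reduce to `φ β` and `ψ α` by computation.
  , λ α β → ◁≈φ α β , ▷≈ψ α β
  where
  open Group Ω renaming (_∙_ to _⋆_)
  open IsExtendedDiassociativeSemigroup eds
  open Relation.Binary.Reasoning.Setoid setoid

  -- Here `ε` is only a representative: any other element in its place gives the same maps up to
  -- `≈`.
  φ ψ : Op₁ Carrier
  φ x = ε ◁ x
  ψ x = x ▷ ε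

  -- Once `α` is written as `α ⋆ ε`, the axiom `⇾-◁` discards the left factor `α`.
  ◁≈φ : ∀ α β → (α ◁ β) ≈ φ β
  ◁≈φ α β = trans (◁-cong (sym (identityʳ α)) refl) (⇾-◁ α ε β)

  ▷≈ψ : ∀ α β → (α ▷ β) ≈ ψ α
  ▷≈ψ α β = trans (▷-cong refl (sym (identityˡ β))) (▷-← α ε β)

  -- The axiom `◁-←-◁` becomes multiplicativity as soon as the left argument of `◁` is irrelevant.
  φ-homo : ∀ x y → φ (x ⋆ y) ≈ (φ x ⋆ φ y)
  φ-homo x y = begin
    φ (x ⋆ y)                ≈⟨ ◁-←-◁ ε x y ⟨
    φ x ⋆ ((ε ⋆ x) ◁ y)      ≈⟨ ∙-congˡ (◁≈φ (ε ⋆ x) y) ⟩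
    φ x ⋆ φ y                ∎

  ψ-homo : ∀ x y → ψ (x ⋆ y) ≈ (ψ x ⋆ ψ y)
  ψ-homo x y = begin
    ψ (x ⋆ y)                ≈⟨ ▷-←-▷ x y ε ⟨
    (x ▷ (y ⋆ ε)) ⋆ ψ y      ≈⟨ ∙-congʳ (▷≈ψ x (y ⋆ ε)) ⟩
    ψ x ⋆ ψ y                ∎

  φ-endo : Endomorphism Ω φ
  φ-endo = multiplicative⇒endomorphism Ω (◁-cong refl) φ-homo

  ψ-endo : Endomorphism Ω ψ
  ψ-endo = multiplicative⇒endomorphism Ω (λ x≈y → ▷-cong x≈y refl) ψ-homo

  -- Only right arguments of `◁` matter, so the nested left side of `◁-◁-◁` collapses to `φ (φ x)`.
  φφ≈φ : ∀ x → φ (φ x) ≈ φ x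
  φφ≈φ x = begin
    φ (φ x)                         ≈⟨ ◁-cong refl (◁≈φ (ε ⋆ ε) x) ⟨
    φ ((ε ⋆ ε) ◁ x)                 ≈⟨ ◁≈φ (ε ◁ ε) ((ε ⋆ ε) ◁ x) ⟨
    (ε ◁ ε) ◁ ((ε ⋆ ε) ◁ x)         ≈⟨ ◁-◁-◁ ε ε x ⟩
    φ x                             ∎

  -- The mixed axiom `▷-◁-▷` has `ψ x` as the right argument of its outer `◁`; the left argument is
  -- forgotten.
  φψ≈φ : ∀ x → φ (ψ x) ≈ φ x
  φψ≈φ x = begin
    φ (ψ x)                         ≈⟨ ◁≈φ (ε ▷ (x ⋆ ε)) (ψ x) ⟨
    (ε ▷ (x ⋆ ε)) ◁ (x ▷ ε)         ≈⟨ ▷-◁-▷ ε x ε ⟩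
    φ x                             ∎

  -- Mirror image, from `◁-▷-◁`: the outer `▷` sees only its left argument `φ x`.
  ψφ≈ψ : ∀ x → ψ (φ x) ≈ ψ x
  ψφ≈ψ x = begin
    ψ (φ x)                         ≈⟨ ▷≈ψ (φ x) ((ε ⋆ x) ◁ ε) ⟨
    (ε ◁ x) ▷ ((ε ⋆ x) ◁ ε)         ≈⟨ ◁-▷-◁ ε x ε ⟩
    ψ x                             ∎
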